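{- Let $F$ be a recurrent set and let $X\subset F$ be a bifix code of finite $F$-degree $d\ge 2$. Let $I=I(X)$, $K=K(X)$, $G=(IA\cap F)\setminus I$ and $D=(AI\cap F)\setminus I$. Then $X'=K\cup(G\cap D)$ is a bifix code of $F$-degree $d-1$.
   Context: $A$ is a finite alphabet. $F\subset A^*$ is recurrent if it is nonempty, closed under factors, and for all $u,w\in F$ there is $v\in F$ with $uvw\in F$. A bifix code is a set of nonempty words none of which is a proper prefix or proper suffix of another. A parse of $w$ with respect to $X$ is a triple $(v,x,u)$ with $w=vxu$, $v$ having no suffix in $X$, $x\in X^*$, $u$ having no prefix in $X$; $\delta_X(w)$ is the number of parses and the $F$-degree is $d_F(X)=\max_{w\in F}\delta_X(w)$. $I(X)=\{w\in A^*\mid A^+wA^+\cap X\neq\emptyset\}$ is the set of internal factors of $X$, and $K(X)=X\cap I(X)$ is the kernel of $X$. -}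

module Defs where

open import Level using (0ℓ)
open import Data.Nat using (ℕ; _≤_)
open import Data.List using (List; []; [_]; _++_; concat; length)
open import Data.List.Relation.Unary.All using (All)
open import Data.List.Relation.Unary.Unique.Propositional using (Unique)
import Data.List.Membership.Propositional as Mem
open import Data.Product using (∃-syntax; _×_; _,_)
open import Function.Bundles using (_⇔_)
open import Relation.Nullary using (¬_)
open import Relation.Unary using (Pred; _∈_; _∉_; _≬_; _∩_; ｛_｝; Satisfiable)
open import Relation.Binary.PropositionalEquality using (_≡_; _≢_)

Lang : Set → Set₁
Lang A = Pred (List A) 0ℓ

module _ {A : Set} where

  infixr 8 _·_
  infix 9 _*

  _·_ : Lang A → Lang A → Lang A
  (L · M) w = ∃[ u ] ∃[ v ] (u ∈ L × v ∈ M × w ≡ u ++ v)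

  Letters : Lang A
  Letters w = ∃[ a ] (w ≡ [ a ])

  A⁺ : Lang A
  A⁺ w = w ≢ []

  _* : Lang A → Lang A
  (X *) w = ∃[ xs ] (All X xs × w ≡ concat xs)

  Prefix Suffix ProperPrefix ProperSuffix : List A → List A → Set
  Prefix u w = ∃[ s ] (w ≡ u ++ s)
  Suffix u w = ∃[ p ] (w ≡ p ++ u)
  ProperPrefix u w = Prefix u w × u ≢ w
  ProperSuffix u w = Suffix u w × u ≢ w

  record Recurrent (F : Lang A) : Set where
    field
      nonempty     : Satisfiable F
      factorClosed : ∀ p u s → p ++ u ++ s ∈ F → u ∈ F
      recurrence   : ∀ u w → u ∈ F → w ∈ F →
                     ∃[ v ] (v ∈ F × u ++ v ++ w ∈ F)

  record BifixCode (X : Lang A) : Set where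
    field
      nonemptyWords : ∀ x → x ∈ X → x ≢ []
      prefixFree    : ∀ x y → x ∈ X → y ∈ X → ¬ ProperPrefix x y
      suffixFree    : ∀ x y → x ∈ X → y ∈ X → ¬ ProperSuffix x y

  IsParse : Lang A → List A → List A × List A × List A → Set
  IsParse X w (v , x , u) =
      w ≡ v ++ x ++ u
    × (∀ s → Suffix s v → s ∉ X)
    × x ∈ X *
    × (∀ p → Prefix p u → p ∉ X)

  -- δ_X(w) = n, as a relation: the set of parses of w is listed without
  -- repetition by n triples. (Triples are counted, not proofs of IsParse.)
  ParseCount : Lang A → List A → ℕ → Set
  ParseCount X w n =
    ∃[ ts ] (Unique ts × (∀ t → (t Mem.∈ ts) ⇔ IsParse X w t) × length ts ≡ n)

  -- d_F(X) = d: the maximum of δ_X over F exists and equals d.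
  record FDegree (F X : Lang A) (d : ℕ) : Set where
    field
      attained : ∃[ w ] (w ∈ F × ParseCount X w d)
      bounded  : ∀ w → w ∈ F → ∃[ n ] (ParseCount X w n × n ≤ d)

  internalFactors : Lang A → Lang A
  internalFactors X w = (A⁺ · ｛ w ｝ · A⁺) ≬ X

  kernel : Lang A → Lang A
  kernel X = X ∩ internalFactors X

{-# OPTIONS --safe #-}
-- Write δ(w) for the number of parses of w.  Extending w by a letter on the
-- left leaves δ unchanged if the new word has a prefix in X and increases it by
-- one otherwise, and symmetrically on the right.  Hence δ is monotone for the
-- factor order and, for w ∈ F, δ(w) = d exactly when w is not internal: if w is
-- not internal and aw ∈ F, then aw extends inside F to a word awvu with δ(u) = d,
-- which must have a prefix in X, and this prefix cannot go beyond aw, so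
-- δ(aw) = δ(w); by recurrence some uvw with δ(u) = d lies in F, so δ(w) = d.
-- The degree claim then follows from δ′(w) = min(δ(w), d − 1) on F, where δ′
-- counts the parses for X′.  In the induction on the last letter, the shortest
-- non-internal suffix of wa provides the suffix in X′ needed once wa is not
-- internal.
module Submission where

open import Defs
open import Level using (0ℓ)
open import Axiom.ExcludedMiddle using (ExcludedMiddle)
open import Data.Empty using (⊥-elim)
open import Data.Nat using (ℕ; suc; _≤_; _<_; _∸_; _⊓_; z≤n; s≤s)
open import Data.Nat.Properties using (≤-refl; ≤-reflexive; ≤-trans; ≤-antisym; ≤-pred; <⇒≱; n≤1+n; m⊓n≤n; module ≤-Reasoning; m≤n⇒m⊓n≡m; m≥n⇒m⊓n≡n)
open import Data.Fin using (Fin)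
open import Data.List using (List; []; _∷_; [_]; _++_; _∷ʳ_; concat; length; map; reverse; initLast; _∷ʳ′_)
open import Data.List.Properties using (++-assoc; ++-identityʳ; ++-conicalˡ; ++-conicalʳ; ∷-injective; ∷ʳ-injectiveˡ; length-map; reverse-++; reverse-involutive; reverse-injective; map-∘; map-cong; ++-identityʳ-unique)
open import Data.List.Reverse using (Reverse; reverseView; []; _∶_∶ʳ_)
open import Data.List.Relation.Unary.All as All using (All; []; _∷_)
open import Data.List.Relation.Unary.All.Properties using (++⁺)
open import Data.List.Relation.Unary.AllPairs using ([]; _∷_)
open import Data.List.Relation.Unary.Any using (here; there)
open import Data.List.Relation.Unary.Unique.Propositional using (Unique)
import Data.List.Relation.Unary.Unique.Propositional.Properties as Unique
open import Data.List.Membership.Propositional.Properties using (∈-map⁺; ∈-map⁻)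
open import Data.List.Membership.Propositional.Properties.WithK using (unique∧set⇒bag)
import Data.List.Membership.Propositional as Mem
open import Data.List.Relation.Binary.BagAndSetEquality using (∼bag⇒↭)
open import Data.List.Relation.Binary.Permutation.Propositional.Properties using (↭-length)
open import Data.Product using (∃-syntax; _×_; _,_; proj₁; proj₂)
open import Data.Sum using (_⊎_; inj₁; inj₂)
open import Function using (_∘_)
open import Function.Bundles using (_↔_; _⇔_; mk⇔; Equivalence)
open import Relation.Nullary using (¬_; Dec; yes; no)
open import Relation.Unary using (_∈_; _∉_; _⊆_; _∩_; _∪_; _∖_)
open import Relation.Binary.PropositionalEquality using (_≡_; _≢_; refl; sym; trans; cong; cong₂; subst; module ≡-Reasoning)

open Equivalence using (to; from)

module _ {A : Set} where

  -- Prefixes and suffixes of words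

  HasPrefix HasSuffix : Lang A → Lang A
  HasPrefix X w = ∃[ p ] (Prefix p w × p ∈ X)
  HasSuffix X w = ∃[ s ] (Suffix s w × s ∈ X)

  prefix-++ : ∀ {p u : List A} v → Prefix p u → Prefix p (u ++ v)
  prefix-++ {p} v (s , refl) = s ++ v , ++-assoc p s v

  suffix-++ : ∀ {s u : List A} p → Suffix s u → Suffix s (p ++ u)
  suffix-++ {s} p (q , refl) = p ++ q , sym (++-assoc p q s)

  suffix-trans : ∀ {s u w : List A} → Suffix s u → Suffix u w → Suffix s w
  suffix-trans s⊑u (p , refl) = suffix-++ p s⊑u

  properSuffix-∷ : ∀ {s w : List A} {a} → Suffix s (a ∷ w) → s ≢ a ∷ w → Suffix s w
  properSuffix-∷ ([]    , eq) s≢ = ⊥-elim (s≢ (sym eq))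
  properSuffix-∷ (_ ∷ p , eq) _  = p , proj₂ (∷-injective eq)

  properPrefix-∷ʳ : ∀ {p w : List A} {a} → Prefix p (w ∷ʳ a) → p ≢ w ∷ʳ a → Prefix p w
  properPrefix-∷ʳ {p} {w} (s , eq) p≢ with initLast s
  ... | []       = ⊥-elim (p≢ (sym (trans eq (++-identityʳ p))))
  ... | t ∷ʳ′ b = t , ∷ʳ-injectiveˡ w (p ++ t) (trans eq (sym (++-assoc p t [ b ])))

  suffix-length : ∀ {s w : List A} → Suffix s w → length s ≤ length w
  suffix-length ([]    , refl) = ≤-refl
  suffix-length (_ ∷ p , refl) = ≤-trans (suffix-length (p , refl)) (n≤1+n _)

  -- Reversal

  infix 9 _ʳ

  _ʳ : Lang A → Lang A
  (X ʳ) w = reverse w ∈ X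

  prefix-reverse : ∀ {p w : List A} → Prefix p w → Suffix (reverse p) (reverse w)
  prefix-reverse {p} (s , refl) = reverse s , reverse-++ p s

  suffix-reverse : ∀ {s w : List A} → Suffix s w → Prefix (reverse s) (reverse w)
  suffix-reverse {s} (p , refl) = reverse p , reverse-++ p s

  hasSuffix⇒hasPrefixʳ : ∀ {X w} → HasSuffix X w → HasPrefix (X ʳ) (reverse w)
  hasSuffix⇒hasPrefixʳ {X} (s , suf , s∈) =
    reverse s , suffix-reverse suf , subst X (sym (reverse-involutive s)) s∈

  hasPrefixʳ⇒hasSuffix : ∀ {X w} → HasPrefix (X ʳ) (reverse w) → HasSuffix X w
  hasPrefixʳ⇒hasSuffix {X} {w} (p , pre , p∈) =
    reverse p , subst (Suffix (reverse p)) (reverse-involutive w) (prefix-reverse pre) , p∈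

  bifixCode-ʳ : ∀ {X} → BifixCode X → BifixCode (X ʳ)
  bifixCode-ʳ bif = record
    { nonemptyWords = λ x x∈ x≡[] → nonemptyWords (reverse x) x∈ (cong reverse x≡[])
    ; prefixFree = λ x y x∈ y∈ (pre , x≢y) →
        suffixFree _ _ x∈ y∈ (prefix-reverse pre , x≢y ∘ reverse-injective)
    ; suffixFree = λ x y x∈ y∈ (suf , x≢y) →
        prefixFree _ _ x∈ y∈ (suffix-reverse suf , x≢y ∘ reverse-injective)
    }
    where open BifixCode bif

  *-reverse : ∀ {X Y : Lang A} → (∀ {w} → w ∈ X → reverse w ∈ Y) →
              ∀ {w} → w ∈ X * → reverse w ∈ Y *
  *-reverse X⇒Y ([]     , []        , refl) = [] , [] , refl
  *-reverse X⇒Y (x ∷ xs , x∈ ∷ xs∈ , refl)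
    with *-reverse X⇒Y (xs , xs∈ , refl)
  ... | ys , ys∈ , eq = ys ∷ʳ reverse x , ++⁺ ys∈ (X⇒Y x∈ ∷ []) , (begin
    reverse (x ++ concat xs)           ≡⟨ reverse-++ x (concat xs) ⟩
    reverse (concat xs) ++ reverse x   ≡⟨ cong (_++ reverse x) eq ⟩
    concat ys ++ reverse x             ≡⟨ concat-∷ʳ ys (reverse x) ⟩
    concat (ys ∷ʳ reverse x)           ∎)
    where
    open ≡-Reasoning
    concat-∷ʳ : ∀ (zs : List (List A)) z → concat zs ++ z ≡ concat (zs ∷ʳ z)
    concat-∷ʳ []       z = sym (++-identityʳ z)
    concat-∷ʳ (y ∷ zs) z = trans (++-assoc y (concat zs) z) (cong (y ++_) (concat-∷ʳ zs z))

  Triple : Set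
  Triple = List A × List A × List A

  reverseTriple : Triple → Triple
  reverseTriple (v , x , u) = reverse u , reverse x , reverse v

  reverseTriple-involutive : ∀ t → reverseTriple (reverseTriple t) ≡ t
  reverseTriple-involutive (v , x , u) =
    cong₂ _,_ (reverse-involutive v) (cong₂ _,_ (reverse-involutive x) (reverse-involutive u))

  -- Reversal exchanges the two outer components: `X⇒Y` carries the middle factor over, and `Y⇒X`
  -- carries the two avoidance conditions back. Keeping `X` and `Y` separate allows passage from `X`
  -- to `X ʳ` and in the opposite direction, since double reversal is the identity only
  -- propositionally.
  isParse-reverse : ∀ {X Y : Lang A} → (∀ {w} → w ∈ X → reverse w ∈ Y) →
                    (∀ {w} → w ∈ Y → reverse w ∈ X) →
                    ∀ {w} t → IsParse X w t → IsParse Y (reverse w) (reverseTriple t)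
  isParse-reverse X⇒Y Y⇒X (v , x , u) (refl , v∌ , x∈ , u∌) =
      (begin
        reverse (v ++ x ++ u)                   ≡⟨ reverse-++ v (x ++ u) ⟩
        reverse (x ++ u) ++ reverse v           ≡⟨ cong (_++ reverse v) (reverse-++ x u) ⟩
        (reverse u ++ reverse x) ++ reverse v   ≡⟨ ++-assoc (reverse u) _ _ ⟩
        reverse u ++ reverse x ++ reverse v     ∎)
    , (λ s suf s∈ → u∌ (reverse s)
        (subst (Prefix (reverse s)) (reverse-involutive u) (suffix-reverse suf)) (Y⇒X s∈))
    , *-reverse X⇒Y x∈
    , (λ p pre p∈ → v∌ (reverse p)
        (subst (Suffix (reverse p)) (reverse-involutive v) (prefix-reverse pre)) (Y⇒X p∈))
    where open ≡-Reasoning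

  parseCount-ʳ : ∀ {X w n} → ParseCount (X ʳ) (reverse w) n → ParseCount X w n
  parseCount-ʳ {X} {w} (ts , uniq , mem , len) =
      map reverseTriple ts
    , Unique.map⁺ reverseTriple-injective uniq
    , (λ t → mk⇔ (sound t) (complete t))
    , trans (length-map reverseTriple ts) len
    where
    reverseTriple-injective : ∀ {s t} → reverseTriple s ≡ reverseTriple t → s ≡ t
    reverseTriple-injective {s} {t} eq = trans (sym (reverseTriple-involutive s))
      (trans (cong reverseTriple eq) (reverseTriple-involutive t))
    X⇒Xʳ : ∀ {w} → w ∈ X → reverse w ∈ X ʳ
    X⇒Xʳ {w} = subst X (sym (reverse-involutive w))
    sound : ∀ t → t Mem.∈ map reverseTriple ts → IsParse X w t
    sound t t∈ with ∈-map⁻ reverseTriple t∈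
    ... | s , s∈ , refl = subst (λ w → IsParse X w (reverseTriple s)) (reverse-involutive w)
      (isParse-reverse (λ p → p) X⇒Xʳ s (to (mem s) s∈))
    complete : ∀ t → IsParse X w t → t Mem.∈ map reverseTriple ts
    complete t p = subst (Mem._∈ map reverseTriple ts) (reverseTriple-involutive t)
      (∈-map⁺ reverseTriple (from (mem _) (isParse-reverse X⇒Xʳ (λ p → p) t p)))

  -- Two repetition-free lists with the same members are permutations of each other. This makes the
  -- relation `ParseCount` functional, so the numbers given by `FDegree` can be compared with `δ`.
  parseCount-unique : ∀ {X : Lang A} {w m n} → ParseCount X w m → ParseCount X w n → m ≡ n
  parseCount-unique (ss , uniqₛ , memₛ , refl) (ts , uniqₜ , memₜ , refl) =
    ↭-length (∼bag⇒↭ (unique∧set⇒bag uniqₛ uniqₜ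
      (λ {t} → mk⇔ (from (memₜ t) ∘ to (memₛ t)) (from (memₛ t) ∘ to (memₜ t)))))

  -- Internal factors

  module _ {X : Lang A} where

    internal⁺ : ∀ p w s → p ≢ [] → s ≢ [] → p ++ w ++ s ∈ X → w ∈ internalFactors X
    internal⁺ p w s p≢ s≢ pws∈ =
      p ++ w ++ s , (p , w ++ s , p≢ , (w , s , refl , s≢ , refl) , refl) , pws∈

    internal⁻ : ∀ {w} → w ∈ internalFactors X →
                ∃[ p ] ∃[ s ] (p ≢ [] × s ≢ [] × p ++ w ++ s ∈ X)
    internal⁻ (_ , (p , _ , p≢ , (_ , s , refl , s≢ , refl) , refl) , pws∈) =
      p , s , p≢ , s≢ , pws∈

    internal-suffix : ∀ {s w} → Suffix s w → w ∈ internalFactors X → s ∈ internalFactors X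
    internal-suffix {s} (q , refl) w∈ with internal⁻ w∈
    ... | p , r , p≢ , r≢ , x∈ =
      internal⁺ (p ++ q) s r (p≢ ∘ ++-conicalˡ p q) r≢ (subst X eq x∈)
      where
      eq : p ++ (q ++ s) ++ r ≡ (p ++ q) ++ s ++ r
      eq = trans (cong (p ++_) (++-assoc q s r)) (sym (++-assoc p q (s ++ r)))

    internal-prefix : ∀ {u w} → Prefix u w → w ∈ internalFactors X → u ∈ internalFactors X
    internal-prefix {u} (q , refl) w∈ with internal⁻ w∈
    ... | p , r , p≢ , r≢ , x∈ =
      internal⁺ p u (q ++ r) p≢ (r≢ ∘ ++-conicalʳ q r)
        (subst (λ z → p ++ z ∈ X) (++-assoc u q r) x∈)

-- Counting parses

module _ (em : ExcludedMiddle 0ℓ) {A : Set} where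

  countStep : ∀ {P : Set} → Dec P → ℕ → ℕ
  countStep (yes _) n = n
  countStep (no _)  n = suc n

  -- For a bifix code this is the number of parses, by `parseCount-δ`; the value 1 counts the parse
  -- of the empty word into three empty words.
  δ : Lang A → List A → ℕ
  δ X []      = 1
  δ X (a ∷ w) = countStep (em {HasPrefix X (a ∷ w)}) (δ X w)

  δ-∷-yes : ∀ {X a w} → HasPrefix X (a ∷ w) → δ X (a ∷ w) ≡ δ X w
  δ-∷-yes {X} {a} {w} h with em {HasPrefix X (a ∷ w)}
  ... | yes _ = refl
  ... | no ¬h = ⊥-elim (¬h h)

  δ-∷-no : ∀ {X a w} → ¬ HasPrefix X (a ∷ w) → δ X (a ∷ w) ≡ suc (δ X w)
  δ-∷-no {X} {a} {w} ¬h with em {HasPrefix X (a ∷ w)}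
  ... | yes h = ⊥-elim (¬h h)
  ... | no _  = refl

  module _ {X : Lang A} (bif : BifixCode X) where
    open BifixCode bif

    []∌ : ∀ {s} → Suffix s [] → s ∉ X
    []∌ {s} (p , eq) s∈ = nonemptyWords s s∈ (++-conicalʳ p s (sym eq))

    remainder : Triple {A} → List A
    remainder (_ , _ , u) = u

    -- In a parse, `v` has no suffix in `X`, so a suffix of `a ∷ v` in `X` can only be `a ∷ v`
    -- itself; it then becomes the first factor of the middle component.
    prepend : A → Triple → Triple
    prepend a (v , x , u) with em {HasSuffix X (a ∷ v)}
    ... | yes _ = [] , (a ∷ v) ++ x , u
    ... | no  _ = a ∷ v , x , u

    remainder-prepend : ∀ a t → remainder (prepend a t) ≡ remainder t
    remainder-prepend a (v , x , u) with em {HasSuffix X (a ∷ v)}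
    ... | yes _ = refl
    ... | no  _ = refl

    prepend-yes : ∀ {a v x u} → HasSuffix X (a ∷ v) →
                  prepend a (v , x , u) ≡ ([] , (a ∷ v) ++ x , u)
    prepend-yes {a} {v} h with em {HasSuffix X (a ∷ v)}
    ... | yes _ = refl
    ... | no ¬h = ⊥-elim (¬h h)

    prepend-no : ∀ {a v x u} → ¬ HasSuffix X (a ∷ v) →
                 prepend a (v , x , u) ≡ (a ∷ v , x , u)
    prepend-no {a} {v} ¬h with em {HasSuffix X (a ∷ v)}
    ... | yes h = ⊥-elim (¬h h)
    ... | no _  = refl

    prepend-isParse : ∀ a {w} t → IsParse X w t → IsParse X (a ∷ w) (prepend a t)
    prepend-isParse a (v , x , u) (refl , v∌ , (xs , xs∈ , refl) , u∌)
      with em {HasSuffix X (a ∷ v)}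
    ... | no ¬h = refl , (λ s suf s∈ → ¬h (s , suf , s∈)) , (xs , xs∈ , refl) , u∌
    ... | yes (s , ([] , refl) , av∈) =
      sym (++-assoc (a ∷ v) x u) , (λ s → []∌) , ((a ∷ v) ∷ xs , av∈ ∷ xs∈ , refl) , u∌
    ... | yes (s , (_ ∷ p , eq) , s∈) = ⊥-elim (v∌ s (p , proj₂ (∷-injective eq)) s∈)

    -- The parses of `a ∷ w` are those obtained from parses of `w`, and one further parse exactly
    -- when `a ∷ w` has no prefix in `X`.
    data ParseOfCons (a : A) (w : List A) : Triple → Set where
      empty     : ¬ HasPrefix X (a ∷ w) → ParseOfCons a w ([] , [] , a ∷ w)
      prepended : ∀ {t} → IsParse X w t → ParseOfCons a w (prepend a t)

    parseOfCons : ∀ {a w} t → IsParse X (a ∷ w) t → ParseOfCons a w t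
    parseOfCons (b ∷ v , x , u) (refl , bv∌ , x∈ , u∌) =
      subst (ParseOfCons _ _) (prepend-no λ (s , suf , s∈) → bv∌ s suf s∈)
        (prepended (refl , (λ s suf → bv∌ s (suffix-++ [ b ] suf)) , x∈ , u∌))
    parseOfCons ([] , _ , u) (refl , _ , ([] , [] , refl) , u∌) =
      empty λ (p , pre , p∈) → u∌ p pre p∈
    parseOfCons ([] , _ , u) (eq , _ , ([] ∷ xs , x∈ ∷ xs∈ , refl) , u∌) =
      ⊥-elim (nonemptyWords [] x∈ refl)
    -- To undo `prepend`, the first factor `b ∷ y` loses its letter and `y` becomes the left
    -- component; a suffix of `y` in `X` would be a proper suffix of `b ∷ y`.
    parseOfCons ([] , _ , u) (refl , _ , ((b ∷ y) ∷ xs , x∈ ∷ xs∈ , refl) , u∌) =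
      subst (ParseOfCons _ _) (prepend-yes (b ∷ y , ([] , refl) , x∈))
        (prepended (++-assoc y (concat xs) u , y∌ , (xs , xs∈ , refl) , u∌))
      where
      y∌ : ∀ s → Suffix s y → s ∉ X
      y∌ s suf s∈ = suffixFree s (b ∷ y) s∈ x∈
        (suffix-++ [ b ] suf , λ { refl → <⇒≱ ≤-refl (suffix-length suf) })

    remainder-isSuffix : ∀ {w} t → IsParse X w t → Suffix (remainder t) w
    remainder-isSuffix (v , x , u) (refl , _) = v ++ x , sym (++-assoc v x u)

    -- A parse is determined by its last component; carrying the distinctness of
    -- these components through the induction avoids showing prepend injective.
    ParseList : List A → ℕ → Set
    ParseList w n = ∃[ ts ] (Unique (map remainder ts) ×
                             (∀ t → (t Mem.∈ ts) ⇔ IsParse X w t) × length ts ≡ n)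

    parseList-[] : ParseList [] 1
    parseList-[] = [ [] , [] , [] ] , [] ∷ [] , (λ t → mk⇔ (sound t) (complete t)) , refl
      where
      sound : ∀ t → t Mem.∈ [ [] , [] , [] ] → IsParse X [] t
      sound t (here refl) = refl , (λ s → []∌) , ([] , [] , refl) ,
        λ { p (s , eq) p∈ → nonemptyWords p p∈ (++-conicalˡ p s (sym eq)) }
      complete : ∀ t → IsParse X [] t → t Mem.∈ [ [] , [] , [] ]
      complete ([] , [] , [])    _        = here refl
      complete ([] , [] , _ ∷ _) (() , _)
      complete ([] , _ ∷ _ , _)  (() , _)
      complete (_ ∷ _ , _ , _)   (() , _)

    map-prepend-isParse : ∀ {a w ts} → (∀ t → (t Mem.∈ ts) ⇔ IsParse X w t) →
                          ∀ {t} → t Mem.∈ map (prepend a) ts → IsParse X (a ∷ w) t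
    map-prepend-isParse {a} mem t∈ with ∈-map⁻ (prepend a) t∈
    ... | s , s∈ , refl = prepend-isParse a s (to (mem s) s∈)

    remainders-prepend : ∀ a ts → map remainder (map (prepend a) ts) ≡ map remainder ts
    remainders-prepend a ts = trans (sym (map-∘ ts)) (map-cong (remainder-prepend a) ts)

    parseList-∷-yes : ∀ {a w n} → HasPrefix X (a ∷ w) → ParseList w n → ParseList (a ∷ w) n
    parseList-∷-yes {a} {w} h (ts , uniq , mem , len) =
        map (prepend a) ts
      , subst Unique (sym (remainders-prepend a ts)) uniq
      , (λ t → mk⇔ (map-prepend-isParse mem) (λ p → complete (parseOfCons t p)))
      , trans (length-map (prepend a) ts) len
      where
      complete : ∀ {t} → ParseOfCons a w t → t Mem.∈ map (prepend a) ts
      complete (empty ¬h)    = ⊥-elim (¬h h)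
      complete (prepended p) = ∈-map⁺ (prepend a) (from (mem _) p)

    parseList-∷-no : ∀ {a w n} → ¬ HasPrefix X (a ∷ w) → ParseList w n →
                     ParseList (a ∷ w) (suc n)
    parseList-∷-no {a} {w} ¬h (ts , uniq , mem , len) =
        ([] , [] , a ∷ w) ∷ map (prepend a) ts
      , All.tabulate fresh ∷ subst Unique (sym (remainders-prepend a ts)) uniq
      , (λ t → mk⇔ sound (λ p → complete (parseOfCons t p)))
      , cong suc (trans (length-map (prepend a) ts) len)
      where
      -- The last component of a parse of `w` is a suffix of `w`, hence shorter than `a ∷ w`.
      fresh : ∀ {u} → u Mem.∈ map remainder (map (prepend a) ts) → a ∷ w ≢ u
      fresh u∈ refl with ∈-map⁻ remainder (subst (_ Mem.∈_) (remainders-prepend a ts) u∈)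
      ... | s , s∈ , eq = <⇒≱ ≤-refl
        (suffix-length (subst (λ u → Suffix u w) (sym eq) (remainder-isSuffix s (to (mem s) s∈))))
      sound : ∀ {t} → t Mem.∈ ([] , [] , a ∷ w) ∷ map (prepend a) ts → IsParse X (a ∷ w) t
      sound (here refl) =
        refl , (λ s → []∌) , ([] , [] , refl) , (λ p pre p∈ → ¬h (p , pre , p∈))
      sound (there t∈)  = map-prepend-isParse mem t∈
      complete : ∀ {t} → ParseOfCons a w t → t Mem.∈ ([] , [] , a ∷ w) ∷ map (prepend a) ts
      complete (empty _)     = here refl
      complete (prepended p) = there (∈-map⁺ (prepend a) (from (mem _) p))

    parseList : ∀ w → ParseList w (δ X w)
    parseList []      = parseList-[]
    parseList (a ∷ w) with em {HasPrefix X (a ∷ w)}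
    ... | yes h = parseList-∷-yes h (parseList w)
    ... | no ¬h = parseList-∷-no ¬h (parseList w)

    parseCount-δ : ∀ w → ParseCount X w (δ X w)
    parseCount-δ w with parseList w
    ... | ts , uniq , rest = ts , Unique.map⁻ uniq , rest

  -- Extension on the right and monotonicity of `δ`

  module _ {X : Lang A} (bif : BifixCode X) where

    -- Both sides count the same parses up to reversal. This turns the recursion on the first letter
    -- into rules for the last letter.
    δ-reverse : ∀ w → δ X w ≡ δ (X ʳ) (reverse w)
    δ-reverse w = parseCount-unique (parseCount-δ bif w)
      (parseCount-ʳ (parseCount-δ (bifixCode-ʳ bif) (reverse w)))

    δ-∷ʳ : ∀ w a → δ X (w ∷ʳ a) ≡ δ (X ʳ) (a ∷ reverse w)
    δ-∷ʳ w a = trans (δ-reverse (w ∷ʳ a)) (cong (δ (X ʳ)) (reverse-++ w [ a ]))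

    δ-∷ʳ-yes : ∀ {w a} → HasSuffix X (w ∷ʳ a) → δ X (w ∷ʳ a) ≡ δ X w
    δ-∷ʳ-yes {w} {a} h = trans (δ-∷ʳ w a) (trans
      (δ-∷-yes (subst (HasPrefix (X ʳ)) (reverse-++ w [ a ]) (hasSuffix⇒hasPrefixʳ h)))
      (sym (δ-reverse w)))

    δ-∷ʳ-no : ∀ {w a} → ¬ HasSuffix X (w ∷ʳ a) → δ X (w ∷ʳ a) ≡ suc (δ X w)
    δ-∷ʳ-no {w} {a} ¬h = trans (δ-∷ʳ w a) (trans
      (δ-∷-no (¬h ∘ hasPrefixʳ⇒hasSuffix ∘ subst (HasPrefix (X ʳ)) (sym (reverse-++ w [ a ]))))
      (cong suc (sym (δ-reverse w))))

    δ-∷-mono : ∀ a w → δ X w ≤ δ X (a ∷ w)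
    δ-∷-mono a w with em {HasPrefix X (a ∷ w)}
    ... | yes _ = ≤-refl
    ... | no _  = n≤1+n _

    δ-∷ʳ-mono : ∀ w a → δ X w ≤ δ X (w ∷ʳ a)
    δ-∷ʳ-mono w a with em {HasSuffix X (w ∷ʳ a)}
    ... | yes h = ≤-reflexive (sym (δ-∷ʳ-yes h))
    ... | no ¬h = ≤-trans (n≤1+n _) (≤-reflexive (sym (δ-∷ʳ-no ¬h)))

    δ-∷ʳ-≤ : ∀ w a → δ X (w ∷ʳ a) ≤ suc (δ X w)
    δ-∷ʳ-≤ w a with em {HasSuffix X (w ∷ʳ a)}
    ... | yes h = ≤-trans (≤-reflexive (δ-∷ʳ-yes h)) (n≤1+n _)
    ... | no ¬h = ≤-reflexive (δ-∷ʳ-no ¬h)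

    δ-++ˡ-mono : ∀ p w → δ X w ≤ δ X (p ++ w)
    δ-++ˡ-mono []      w = ≤-refl
    δ-++ˡ-mono (a ∷ p) w = ≤-trans (δ-++ˡ-mono p w) (δ-∷-mono a (p ++ w))

    δ-++ʳ-mono : ∀ w s → δ X w ≤ δ X (w ++ s)
    δ-++ʳ-mono w []      = ≤-reflexive (cong (δ X) (sym (++-identityʳ w)))
    δ-++ʳ-mono w (a ∷ s) = ≤-trans (δ-∷ʳ-mono w a) (≤-trans (δ-++ʳ-mono (w ∷ʳ a) s)
      (≤-reflexive (cong (δ X) (++-assoc w [ a ] s))))

-- The derived code

module _ {A : Set} where

  prefix-compare : ∀ (p : List A) {s} u {z} → p ++ s ≡ u ++ z →
                   Prefix p u ⊎ ∃[ q ] (q ≢ [] × p ≡ u ++ q)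
  prefix-compare []      u       _  = inj₁ (u , refl)
  prefix-compare (a ∷ p) []      _  = inj₂ (a ∷ p , (λ ()) , refl)
  prefix-compare (a ∷ p) (b ∷ u) eq with ∷-injective eq
  ... | refl , eq′ with prefix-compare p u eq′
  ...   | inj₁ (s , refl)     = inj₁ (s , refl)
  ...   | inj₂ (q , q≢ , refl) = inj₂ (q , q≢ , refl)

  prefix-++-proper : ∀ {p u : List A} s → s ≢ [] → Prefix p u → p ≢ u ++ s
  prefix-++-proper {p} s s≢ (r , refl) eq = s≢ (++-conicalʳ r s
    (++-identityʳ-unique p (trans eq (++-assoc p r s))))

  ∷⇒∷ʳ : ∀ (b : A) t → ∃[ u ] ∃[ a ] (b ∷ t ≡ u ∷ʳ a)
  ∷⇒∷ʳ b []      = [] , b , refl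
  ∷⇒∷ʳ b (c ∷ t) with ∷⇒∷ʳ c t
  ... | u , a , eq = b ∷ u , a , cong (b ∷_) eq

module _ (em : ExcludedMiddle 0ℓ) {A : Set} {F X : Lang A} {e : ℕ}
         (rec : Recurrent F) (X⊆F : X ⊆ F) (bif : BifixCode X)
         (deg : FDegree F X (suc (suc e))) where
  open Recurrent rec
  open BifixCode bif
  open FDegree deg

  private
    d = suc (suc e)
    I = internalFactors X
    δX = δ em X

  -- Internal factors and the maximal number of parses

  F-prefix : ∀ {u w} → Prefix u w → w ∈ F → u ∈ F
  F-prefix {u} (s , refl) = factorClosed [] u s

  F-suffix : ∀ {s w} → Suffix s w → w ∈ F → s ∈ F
  F-suffix {s} (p , refl) w∈ =
    factorClosed p s [] (subst (λ z → p ++ z ∈ F) (sym (++-identityʳ s)) w∈)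

  δ-bounded : ∀ {w} → w ∈ F → δX w ≤ d
  δ-bounded {w} w∈ with bounded w w∈
  ... | n , pc , n≤d = subst (_≤ d) (parseCount-unique pc (parseCount-δ em bif w)) n≤d

  private
    top = proj₁ attained
    top∈F = proj₁ (proj₂ attained)

  δ-top : δX top ≡ d
  δ-top = parseCount-unique (parseCount-δ em bif top) (proj₂ (proj₂ attained))

  -- By monotonicity `t ++ top` already has at least `d` parses; without a prefix in `X` the letter
  -- `a` would add one more.
  hasPrefix-++top : ∀ {a} t → a ∷ t ++ top ∈ F → HasPrefix X (a ∷ t ++ top)
  hasPrefix-++top {a} t w∈ with em {HasPrefix X (a ∷ t ++ top)}
  ... | yes h = h
  ... | no ¬h = ⊥-elim (<⇒≱
    (s≤s (subst (_≤ δX (t ++ top)) δ-top (δ-++ˡ-mono em bif t top)))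
    (subst (_≤ d) (δ-∷-no em ¬h) (δ-bounded w∈)))

  nonInternal⇒hasPrefix : ∀ {a w} → w ∉ I → a ∷ w ∈ F → HasPrefix X (a ∷ w)
  nonInternal⇒hasPrefix {a} {w} w∉ aw∈ with recurrence (a ∷ w) top aw∈ top∈F
  ... | v , _ , awvu∈
    with hasPrefix-++top (w ++ v) (subst (λ z → a ∷ z ∈ F) (sym (++-assoc w v top)) awvu∈)
  ... | p , (s , eq) , p∈
    with prefix-compare p (a ∷ w) (trans (sym eq) (cong (a ∷_) (++-assoc w v top)))
  ... | inj₁ pre              = p , pre , p∈
  -- A prefix reaching beyond `a ∷ w` has the form `a ∷ w ++ q` and would exhibit `w` as an internal
  -- factor.
  ... | inj₂ (q , q≢ , refl) = ⊥-elim (w∉ (internal⁺ [ a ] w q (λ ()) q≢ p∈))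

  -- Words with a non-internal suffix are non-internal, so every letter of `p` in turn completes a
  -- prefix in `X` and adds no parse.
  nonInternal⇒δ-++ : ∀ p {w} → w ∉ I → p ++ w ∈ F → δX (p ++ w) ≡ δX w
  nonInternal⇒δ-++ []      w∉ _  = refl
  nonInternal⇒δ-++ (a ∷ p) w∉ z∈ = trans
    (δ-∷-yes em (nonInternal⇒hasPrefix (w∉ ∘ internal-suffix (p , refl)) z∈))
    (nonInternal⇒δ-++ p w∉ (F-suffix ([ a ] , refl) z∈))

  nonInternal⇒δ≡d : ∀ {w} → w ∈ F → w ∉ I → δX w ≡ d
  nonInternal⇒δ≡d {w} w∈ w∉ with recurrence top w top∈F w∈
  ... | v , _ , z∈ = ≤-antisym (δ-bounded w∈) (begin
    d                      ≡⟨ δ-top ⟨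
    δX top                 ≤⟨ δ-++ʳ-mono em bif top (v ++ w) ⟩
    δX (top ++ v ++ w)     ≡⟨ cong δX (++-assoc top v w) ⟨
    δX ((top ++ v) ++ w)   ≡⟨ nonInternal⇒δ-++ (top ++ v) w∉ (subst F (sym (++-assoc top v w)) z∈) ⟩
    δX w                   ∎)
    where open ≤-Reasoning

  -- If `b ∷ p ++ w ++ s` lies in `X` with `s` nonempty, then `b ∷ p ++ w` is a proper prefix of a
  -- word of `X` and has no prefix in `X`. Hence the letter `b` adds a parse, and the total is still
  -- at most `d`.
  internal⇒δ<d : ∀ {w} → w ∈ I → δX w < d
  internal⇒δ<d {w} w∈ with internal⁻ w∈
  ... | []    , s , p≢ , _  , _  = ⊥-elim (p≢ refl)
  ... | b ∷ p , s , _  , s≢ , x∈ = begin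
    suc (δX w)          ≤⟨ s≤s (δ-++ˡ-mono em bif p w) ⟩
    suc (δX (p ++ w))   ≡⟨ δ-∷-no em noPrefix ⟨
    δX (b ∷ p ++ w)     ≤⟨ δ-bounded (F-prefix (s , refl) (X⊆F x′∈)) ⟩
    d                   ∎
    where
    open ≤-Reasoning
    x′∈ : (b ∷ p ++ w) ++ s ∈ X
    x′∈ = subst X (sym (++-assoc (b ∷ p) w s)) x∈
    noPrefix : ¬ HasPrefix X (b ∷ p ++ w)
    noPrefix (q , pre , q∈) =
      prefixFree q _ q∈ x′∈ (prefix-++ s pre , prefix-++-proper s s≢ pre)

  -- Otherwise the empty word would have `d` parses, but it has one and `d` is at least 2.
  []∈I : [] ∈ I
  []∈I with em {[] ∈ I}
  ... | yes []∈ = []∈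
  ... | no []∉ with () ← nonInternal⇒δ≡d (F-prefix (top , refl) top∈F) []∉

  -- Letters are removed from the left until the rest is internal, which happens at the empty word
  -- at the latest. For `w` in `F` the suffix found lies in `D`.
  shortestNonInternalSuffix : ∀ w → w ∉ I → ∃[ b ] ∃[ t ] (Suffix (b ∷ t) w × b ∷ t ∉ I × t ∈ I)
  shortestNonInternalSuffix []      w∉ = ⊥-elim (w∉ []∈I)
  shortestNonInternalSuffix (b ∷ w) bw∉ with em {w ∈ I}
  ... | yes w∈ = b , w , ([] , refl) , bw∉ , w∈
  ... | no w∉ with shortestNonInternalSuffix w w∉
  ...   | c , t , suf , rest = c , t , suffix-++ [ b ] suf , rest

  -- The bifix property of `X′`

  private
    K = kernel X
    G = ((I · Letters) ∩ F) ∖ I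
    D = ((Letters · I) ∩ F) ∖ I
    X′ = K ∪ (G ∩ D)

  -- The word is non-internal and so has `d` parses, while it has fewer after removal of its first
  -- letter; that letter therefore adds a parse.
  D⇒noPrefix : ∀ {y} → y ∈ D → ¬ HasPrefix X y
  D⇒noPrefix ((( _ , r , (b , refl) , r∈ , refl) , y∈F) , y∉) h =
    <⇒≱ (internal⇒δ<d r∈)
      (≤-reflexive (trans (sym (nonInternal⇒δ≡d y∈F y∉)) (δ-∷-yes em h)))

  G⇒noSuffix : ∀ {y} → y ∈ G → ¬ HasSuffix X y
  G⇒noSuffix (((t , _ , t∈ , (a , refl) , refl) , y∈F) , y∉) h =
    <⇒≱ (internal⇒δ<d t∈)
      (≤-reflexive (trans (sym (nonInternal⇒δ≡d y∈F y∉)) (δ-∷ʳ-yes em bif h)))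

  -- Words of `G ∩ D` are never internal. Since `X ∩ I` is the kernel, `X` and `X′` thus agree on
  -- internal words.
  X′∩I⊆X : ∀ {x} → x ∈ X′ → x ∈ I → x ∈ X
  X′∩I⊆X (inj₁ (x∈ , _))        _  = x∈
  X′∩I⊆X (inj₂ ((_ , x∉) , _)) x∈ = ⊥-elim (x∉ x∈)

  bifixCode-X′ : BifixCode X′
  bifixCode-X′ = record { nonemptyWords = ne ; prefixFree = pf ; suffixFree = sf }
    where
    ne : ∀ x → x ∈ X′ → x ≢ []
    ne x  (inj₁ (x∈ , _))        = nonemptyWords x x∈
    ne .[] (inj₂ ((_ , []∉) , _)) refl = []∉ []∈I
    pf : ∀ x y → x ∈ X′ → y ∈ X′ → ¬ ProperPrefix x y
    pf x y x∈ (inj₁ (y∈ , y∈I)) (pre , x≢y) =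
      prefixFree x y (X′∩I⊆X x∈ (internal-prefix pre y∈I)) y∈ (pre , x≢y)
    -- Membership in `G` makes the word without its last letter internal, so its prefix `x` is
    -- internal and belongs to `X`; membership in `D` forbids such a prefix. For suffixes `G` and
    -- `D` exchange roles.
    pf x _ x∈ (inj₂ (((( _ , _ , t∈ , (_ , refl) , refl) , _) , _) , y∈D)) (pre , x≢y) =
      D⇒noPrefix y∈D (x , pre , X′∩I⊆X x∈ (internal-prefix (properPrefix-∷ʳ pre x≢y) t∈))
    sf : ∀ x y → x ∈ X′ → y ∈ X′ → ¬ ProperSuffix x y
    sf x y x∈ (inj₁ (y∈ , y∈I)) (suf , x≢y) =
      suffixFree x y (X′∩I⊆X x∈ (internal-suffix suf y∈I)) y∈ (suf , x≢y)
    sf x _ x∈ (inj₂ (y∈G , ((( _ , _ , (_ , refl) , r∈ , refl) , _) , _))) (suf , x≢y) =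
      G⇒noSuffix y∈G (x , suf , X′∩I⊆X x∈ (internal-suffix (properSuffix-∷ suf x≢y) r∈))

  -- The degree of `X′`

  nonInternal⇒hasSuffix : ∀ {u a} → u ∉ I → u ∷ʳ a ∈ F → HasSuffix X (u ∷ʳ a)
  nonInternal⇒hasSuffix {u} {a} u∉ ua∈ with em {HasSuffix X (u ∷ʳ a)}
  ... | yes h = h
  -- The word `u` already has `d` parses, so the letter `a` cannot add one.
  ... | no ¬h = ⊥-elim (<⇒≱ (s≤s (≤-reflexive (sym δu≡d)))
                 (subst (_≤ d) (δ-∷ʳ-no em bif ¬h) (δ-bounded ua∈)))
    where
    δu≡d : δX u ≡ d
    δu≡d = nonInternal⇒δ≡d (F-prefix ([ a ] , refl) ua∈) u∉

  -- Write `b ∷ t` as `u ∷ʳ a`. If `u` is internal, the whole word lies in `G ∩ D`. If not, it has a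
  -- suffix in `X`, which is not the whole word because words of `D` have no prefix in `X`; this
  -- suffix is then a suffix of the internal word `t` and lies in the kernel.
  D⇒hasSuffix-X′ : ∀ b t → t ∈ I → b ∷ t ∈ D → HasSuffix X′ (b ∷ t)
  D⇒hasSuffix-X′ b t t∈ s∈D@((_ , s∈F) , s∉) with ∷⇒∷ʳ b t
  ... | u , a , eq with em {u ∈ I}
  ...   | yes u∈ = b ∷ t , ([] , refl) ,
          inj₂ ((((u , [ a ] , u∈ , (a , refl) , eq) , s∈F) , s∉) , s∈D)
  ...   | no u∉ = fromX (subst (HasSuffix X) (sym eq) (nonInternal⇒hasSuffix u∉ (subst F eq s∈F)))
    where
    fromX : HasSuffix X (b ∷ t) → HasSuffix X′ (b ∷ t)
    fromX (z , suf , z∈) = z , suf , inj₁ (z∈ , internal-suffix (properSuffix-∷ suf z≢s) t∈)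
      where
      z≢s : z ≢ b ∷ t
      z≢s z≡s = D⇒noPrefix s∈D (z , ([] , trans (sym z≡s) (sym (++-identityʳ z))) , z∈)

  nonInternal⇒hasSuffix-X′ : ∀ {w} → w ∈ F → w ∉ I → HasSuffix X′ w
  nonInternal⇒hasSuffix-X′ {w} w∈ w∉ with shortestNonInternalSuffix w w∉
  ... | b , t , suf , s∉ , t∈
    with D⇒hasSuffix-X′ b t t∈ ((([ b ] , t , (b , refl) , t∈ , refl) , F-suffix suf w∈) , s∉)
  ... | z , z-suf , z∈ = z , suffix-trans z-suf suf , z∈

  internal⇒δ⊓≡δ : ∀ {w} → w ∈ I → δX w ⊓ suc e ≡ δX w
  internal⇒δ⊓≡δ w∈ = m≤n⇒m⊓n≡m (≤-pred (internal⇒δ<d w∈))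

  δ-X′ : ∀ w → w ∈ F → δ em X′ w ≡ δX w ⊓ suc e
  δ-X′ w = go (reverseView w)
    where
    open ≡-Reasoning
    go : ∀ {w} → Reverse w → w ∈ F → δ em X′ w ≡ δX w ⊓ suc e
    -- Truncation at `suc e` leaves the single parse of the empty word untouched.
    go []             _   = refl
    go (w ∶ rs ∶ʳ a) wa∈ with em {w ∷ʳ a ∈ I}
    ... | no wa∉ = begin
      δ em X′ (w ∷ʳ a)     ≡⟨ δ-∷ʳ-yes em bifixCode-X′ (nonInternal⇒hasSuffix-X′ wa∈ wa∉) ⟩
      δ em X′ w            ≡⟨ go rs (F-prefix ([ a ] , refl) wa∈) ⟩
      δX w ⊓ suc e         ≡⟨ m≥n⇒m⊓n≡n (≤-pred (subst (_≤ _) δ≡d (δ-∷ʳ-≤ em bif w a))) ⟩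
      suc e                ≡⟨ m≥n⇒m⊓n≡n (n≤1+n _) ⟨
      d ⊓ suc e            ≡⟨ cong (_⊓ suc e) δ≡d ⟨
      δX (w ∷ʳ a) ⊓ suc e  ∎
      where
      δ≡d : δX (w ∷ʳ a) ≡ d
      δ≡d = nonInternal⇒δ≡d wa∈ wa∉
    ... | yes wa∈I = trans step (sym (internal⇒δ⊓≡δ wa∈I))
      where
      ih : δ em X′ w ≡ δX w
      ih = trans (go rs (F-prefix ([ a ] , refl) wa∈))
        (internal⇒δ⊓≡δ (internal-prefix ([ a ] , refl) wa∈I))
      step : δ em X′ (w ∷ʳ a) ≡ δX (w ∷ʳ a)
      step with em {HasSuffix X (w ∷ʳ a)}
      ... | yes h@(s , suf , s∈) =
        trans (δ-∷ʳ-yes em bifixCode-X′ (s , suf , inj₁ (s∈ , internal-suffix suf wa∈I)))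
          (trans ih (sym (δ-∷ʳ-yes em bif h)))
      ... | no ¬h =
        trans (δ-∷ʳ-no em bifixCode-X′
                λ (s , suf , s∈) → ¬h (s , suf , X′∩I⊆X s∈ (internal-suffix suf wa∈I)))
          (trans (cong suc ih) (sym (δ-∷ʳ-no em bif ¬h)))

  fDegree-X′ : FDegree F X′ (suc e)
  fDegree-X′ = record
    { attained = top , top∈F , subst (ParseCount X′ top) δ′-top (parseCount-δ em bifixCode-X′ top)
    ; bounded  = λ w w∈ → δ em X′ w , parseCount-δ em bifixCode-X′ w ,
                          subst (_≤ suc e) (sym (δ-X′ w w∈)) (m⊓n≤n (δX w) (suc e))
    }
    where
    δ′-top : δ em X′ top ≡ suc e
    δ′-top = trans (δ-X′ top top∈F)
      (trans (cong (_⊓ suc e) δ-top) (m≥n⇒m⊓n≡n (n≤1+n _)))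

mainTheorem4 :
    ExcludedMiddle 0ℓ →
    (A : Set) (k : ℕ) → A ↔ Fin k →
    (F X : Lang A) (d : ℕ) →
    Recurrent F → X ⊆ F → BifixCode X → FDegree F X d → 2 ≤ d →
    let I  = internalFactors X
        K  = kernel X
        G  = ((I · Letters) ∩ F) ∖ I
        D  = ((Letters · I) ∩ F) ∖ I
        X′ = K ∪ (G ∩ D)
    in BifixCode X′ × FDegree F X′ (d ∸ 1)
mainTheorem4 em A k A↔Fin F X (suc (suc e)) rec X⊆F bif deg (s≤s (s≤s z≤n)) =
  bifixCode-X′ em rec X⊆F bif deg , fDegree-X′ em rec X⊆F bif deg
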